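{- If $G$ is a $3$-edge-connected graph admitting a nowhere-zero $4$-flow, then $fn(G)\le 2$. In particular, $fn(G)=2$ for every $3$-edge-connected $3$-edge-colourable graph $G$.
   Context: All graphs are finite. An orientation is strong if for every ordered pair of distinct vertices $u,v$ there is a directed $uv$-path. An edge $e$ is deletable in an orientation $(G,o)$ if the restriction of $o$ to $E(G)\setminus\{e\}$ is a strong orientation of $G-e$. For a $3$-edge-connected graph $G$, the Frank number $fn(G)$ is the minimum number $k$ such that $G$ admits $k$ orientations with the property that every edge of $G$ is deletable in at least one of them. A nowhere-zero $k$-flow on $G$ is a pair $(o,f)$ of an orientation $o$ and a map $f:E(G)\to\{\pm1,\dots,\pm(k-1)\}$ such that at every vertex the sum of $f$ over incoming edges equals the sum of $f$ over outgoing edges. -}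

module Defs where

open import Data.Bool using (Bool; if_then_else_)
open import Data.Fin using (Fin; _≟_)
open import Data.Fin.Subset using (Subset; _∉_; ⁅_⁆; ∣_∣)
open import Data.Integer as ℤ using (ℤ; 0ℤ)
open import Data.Integer.Properties using (+-0-commutativeMonoid)
open import Data.List using (List; []; _∷_)
open import Data.List.Relation.Unary.Unique.Propositional using (Unique)
open import Data.Nat using (ℕ; _≤_; _<_)
open import Data.Product using (Σ-syntax; ∃-syntax; _×_; _,_; proj₁; proj₂)
open import Data.Sum using (_⊎_)
open import Relation.Binary.Construct.Closure.ReflexiveTransitive using (Star; ε; _◅_)
open import Relation.Binary.PropositionalEquality using (_≡_; _≢_)
open import Relation.Nullary.Decidable using (⌊_⌋)

open import Algebra.Properties.CommutativeMonoid.Sum +-0-commutativeMonoid using (sum)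

-- Finite graphs; parallel edges and loops are allowed. The order of the two
-- ends of an edge carries no meaning, except as a reference for orientations.
record Graph : Set where
  field
    order : ℕ
    size  : ℕ
    ends  : Fin size → Fin order × Fin order

  V : Set
  V = Fin order

  E : Set
  E = Fin size

open Graph public

module _ {A : Set} {R : A → A → Set} where

  visited : ∀ {u v} → Star R u v → List A
  visited {u} ε       = u ∷ []
  visited {u} (_ ◅ w) = u ∷ visited w

-- A path is a walk that visits no vertex twice.
Path : {A : Set} → (A → A → Set) → A → A → Set
Path R u v = Σ[ w ∈ Star R u v ] Unique (visited w)

module _ (G : Graph) where

  Joins : E G → V G → V G → Set
  Joins e u v = ends G e ≡ (u , v) ⊎ ends G e ≡ (v , u)

  Incident : E G → V G → Set
  Incident e v = proj₁ (ends G e) ≡ v ⊎ proj₂ (ends G e) ≡ v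

  -- Adjacency in G − F.
  Adjacent∖ : Subset (size G) → V G → V G → Set
  Adjacent∖ F u v = ∃[ e ] (e ∉ F × Joins e u v)

  Connected∖ : Subset (size G) → Set
  Connected∖ F = ∀ u v → Path (Adjacent∖ F) u v

  -- As usual, a one-vertex graph is not counted as k-edge-connected.
  EdgeConnected : ℕ → Set
  EdgeConnected k = 2 ≤ order G × (∀ F → ∣ F ∣ < k → Connected∖ F)

  EdgeColourable : ℕ → Set
  EdgeColourable k =
    Σ[ c ∈ (E G → Fin k) ]
      (∀ e e′ v → e ≢ e′ → Incident e v → Incident e′ v → c e ≢ c e′)

  -- true: from the first listed end to the second; false: the reverse.
  Orientation : Set
  Orientation = E G → Bool

  tail : Orientation → E G → V G
  tail o e = if o e then proj₁ (ends G e) else proj₂ (ends G e)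

  head : Orientation → E G → V G
  head o e = if o e then proj₂ (ends G e) else proj₁ (ends G e)

  -- The arcs of the restriction of o to G − F.
  Arc∖ : Orientation → Subset (size G) → V G → V G → Set
  Arc∖ o F u v = ∃[ e ] (e ∉ F × tail o e ≡ u × head o e ≡ v)

  Strong∖ : Orientation → Subset (size G) → Set
  Strong∖ o F = ∀ u v → u ≢ v → Path (Arc∖ o F) u v

  Deletable : Orientation → E G → Set
  Deletable o e = Strong∖ o ⁅ e ⁆

  DeletableCover : ℕ → Set
  DeletableCover k =
    Σ[ o ∈ (Fin k → Orientation) ] (∀ e → ∃[ i ] Deletable (o i) e)

  IsFrankNumber : ℕ → Set
  IsFrankNumber k = DeletableCover k × (∀ j → DeletableCover j → k ≤ j)

  inflow : Orientation → (E G → ℤ) → V G → ℤ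
  inflow o f v = sum (λ e → if ⌊ head o e ≟ v ⌋ then f e else 0ℤ)

  outflow : Orientation → (E G → ℤ) → V G → ℤ
  outflow o f v = sum (λ e → if ⌊ tail o e ≟ v ⌋ then f e else 0ℤ)

  record NowhereZeroFlow (k : ℕ) : Set where
    field
      orientation : Orientation
      flow        : E G → ℤ
      nonzero     : ∀ e → 1 ≤ ℤ.∣ flow e ∣
      bounded     : ∀ e → ℤ.∣ flow e ∣ < k
      conserved   : ∀ v → inflow orientation flow v ≡ outflow orientation flow v

{-# OPTIONS --safe #-}
module Submission where

-- By Eulerian orientations, an integer flow f is congruent mod 2 to a flow x with
-- values in {0, ±1}, and (f − x) / 2 to another such flow y.  If f is a nowhere-zero
-- 4-flow, x and y do not vanish simultaneously; in a 3-edge-coloured cubic graph one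
-- takes x and y supported on two pairs of colours instead.  On every edge x + 2 y and
-- 2 x − y are nonzero and one of them is ±1.  Orienting the edges by the sign of such
-- a flow, an edge e of value ±1 is deletable: were e the only edge leaving a vertex set,
-- conservation would let at most one edge enter it, giving a cut of at most two edges.

open import Data.Bool using (Bool; true; false; not; if_then_else_; _xor_)
import Data.Bool as Bool
open import Data.Bool.Properties using (not-injective)
open import Data.Fin as Fin using (Fin; zero; suc; _≟_)
open import Data.Fin.Properties as Fin using (any?; all?; pigeonhole)
open import Data.Fin.Subset using (Subset; _∈_; ⁅_⁆; ∣_∣; _∪_) renaming (⊥ to ∅)
open import Data.Fin.Subset.Properties
  using (_∈?_; anySubset?; x∈⁅x⁆; x∈⁅y⁆⇒x≡y; p⊆p∪q; q⊆p∪q; x∈p∪q⁻; p⊂q⇒∣p∣<∣q∣; ∣p∣≡n⇒p≡⊤; ∣p∣≤n; ∈⊤; ∣⊥∣≡0)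
open import Data.Integer as ℤ using (ℤ; +_; -[1+_]; 0ℤ; 1ℤ; -1ℤ; _+_; _*_; _-_; -_; +≤+)
open import Data.Integer.Divisibility.Signed
  using (_∣_; divides; ∣⇒∣ᵤ; ∣m∣n⇒∣m+n; ∣m+n∣m⇒∣n; ∣m⇒∣m*n)
open import Data.Integer.DivMod using (_%ℕ_; _/ℕ_; n%ℕd<d; a≡a%ℕn+[a/ℕn]*n)
import Data.Integer.Properties as ℤ
open import Data.Integer.Tactic.RingSolver using (solve-∀)
open import Data.List.Membership.Propositional using () renaming (_∈_ to _∈ₗ_)
open import Data.List.Relation.Unary.All using ([]; _∷_)
open import Data.List.Relation.Unary.All.Properties using (¬Any⇒All¬)
open import Data.List.Relation.Unary.Any using (here; there) renaming (any? to anyₗ?)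
open import Data.List.Relation.Unary.AllPairs using ([]; _∷_)
open import Data.Nat as ℕ using (ℕ; zero; suc; _≤_; _<_; z≤n; s≤s)
import Data.Nat.Divisibility as ℕ
import Data.Nat.Properties as ℕ
open import Data.Product using (Σ-syntax; ∃-syntax; ∃₂; _×_; _,_; proj₁; proj₂)
open import Data.Sum using (_⊎_; inj₁; inj₂)
open import Data.Vec as Vec using (Vec; []; _∷_; tabulate; lookup)
open import Data.Vec.Properties using (lookup∘tabulate; []=⇒lookup; lookup⇒[]=)
open import Data.Vec.Relation.Unary.All using ([]; _∷_)
open import Data.Vec.Relation.Unary.All.Properties using (lookup⁺)
open import Data.Vec.Relation.Unary.AllPairs using ([]; _∷_)
import Data.Vec.Relation.Unary.Unique.Propositional as UniqueV
open import Data.Vec.Relation.Unary.Unique.Propositional.Properties using (lookup-injective)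
open import Function using (_∘_)
open import Relation.Binary.Construct.Closure.ReflexiveTransitive using (Star; ε; _◅_; _◅◅_; gmap)
open import Relation.Binary.Definitions using (DecidableEquality)
open import Relation.Binary.PropositionalEquality
  using (_≡_; _≢_; _≗_; refl; sym; trans; cong; cong₂; subst; subst₂; module ≡-Reasoning)
open import Relation.Nullary using (¬_; Dec; yes; no; contradiction)
open import Relation.Nullary.Decidable using (⌊_⌋; from-yes; map′; ¬?; _×-dec_; _→-dec_)

open import Algebra.Properties.CommutativeMonoid.Sum ℤ.+-0-commutativeMonoid
  using (sum; sum-cong-≗; sum-replicate-zero; ∑-distrib-+; ∑-comm)
open import Algebra.Properties.Semiring.Sum ℤ.+-*-semiring using (*-distribˡ-sum)

open import Defs

-- Integer sums

sum-mono-≤ : ∀ {n} {x y : Fin n → ℤ} → (∀ i → x i ℤ.≤ y i) → sum x ℤ.≤ sum y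
sum-mono-≤ {zero}  x≤y = ℤ.≤-refl
sum-mono-≤ {suc n} x≤y = ℤ.+-mono-≤ (x≤y zero) (sum-mono-≤ (x≤y ∘ suc))

sum-≡0 : ∀ {n} {x : Fin n → ℤ} → (∀ i → x i ≡ 0ℤ) → sum x ≡ 0ℤ
sum-≡0 {n} x≡0 = trans (sum-cong-≗ x≡0) (sum-replicate-zero n)

sum-single : ∀ {n} {x : Fin n → ℤ} i → (∀ j → j ≢ i → x j ≡ 0ℤ) → sum x ≡ x i
sum-single {suc n} {x} zero x≡0 =
  trans (cong (λ z → x zero + z) (sum-≡0 λ j → x≡0 (suc j) λ ())) (ℤ.+-identityʳ _)
sum-single {suc n} {x} (suc i) x≡0 =
  trans (cong₂ _+_ (x≡0 zero λ ()) (sum-single i λ j j≢i → x≡0 (suc j) λ { refl → j≢i refl }))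
        (ℤ.+-identityˡ _)

sum-distrib-- : ∀ {n} (x y : Fin n → ℤ) → sum (λ i → x i - y i) ≡ sum x - sum y
sum-distrib-- {zero}  x y = refl
sum-distrib-- {suc n} x y =
  trans (cong (λ z → x zero - y zero + z) (sum-distrib-- (x ∘ suc) (y ∘ suc)))
        (interchange (x zero) (y zero) _ _)
  where
  interchange : ∀ a b c d → (a - b) + (c - d) ≡ (a + c) - (b + d)
  interchange = solve-∀

-- Isolates the effect of altering one summand; it is applied to a family of edges in which a single
-- edge has been replaced.
sum-change : ∀ {n} (x y : Fin n → ℤ) i → (∀ j → j ≢ i → x j ≡ y j) →
             sum x ≡ sum y + (x i - y i)
sum-change x y i x≡y = begin
  sum x                           ≡⟨ add-back (sum x) (sum y) ⟩
  sum y + (sum x - sum y)         ≡⟨ cong (λ z → sum y + z) (sum-distrib-- x y) ⟨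
  sum y + sum (λ j → x j - y j)   ≡⟨ cong (λ z → sum y + z) (sum-single i λ j j≢i → ℤ.i≡j⇒i-j≡0 (x≡y j j≢i)) ⟩
  sum y + (x i - y i)             ∎
  where
  open ≡-Reasoning
  add-back : ∀ a b → a ≡ b + (a - b)
  add-back = solve-∀

ι : Bool → ℤ
ι b = if b then 1ℤ else 0ℤ

if-then-0 : ∀ b z → (if b then z else 0ℤ) ≡ z * ι b
if-then-0 true  z = sym (ℤ.*-identityʳ z)
if-then-0 false z = sym (ℤ.*-zeroʳ z)

δ : ∀ {n} → Fin n → Fin n → ℤ
δ x y = ι ⌊ x ≟ y ⌋

if-≟-refl : ∀ {A : Set} {n} (i : Fin n) {x y : A} → (if ⌊ i ≟ i ⌋ then x else y) ≡ x
if-≟-refl i with i ≟ i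
... | yes _  = refl
... | no i≢i = contradiction refl i≢i

if-≟-≢ : ∀ {A : Set} {n} {i j : Fin n} {x y : A} → i ≢ j → (if ⌊ i ≟ j ⌋ then x else y) ≡ y
if-≟-≢ {i = i} {j} i≢j with i ≟ j
... | yes i≡j = contradiction i≡j i≢j
... | no _    = refl

if-elim : ∀ {A : Set} (P : A → Set) b {x y} → P x → P y → P (if b then x else y)
if-elim P true  px py = px
if-elim P false px py = py

δ-refl : ∀ {n} (x : Fin n) → δ x x ≡ 1ℤ
δ-refl x = if-≟-refl x

δ-≢ : ∀ {n} {x y : Fin n} → x ≢ y → δ x y ≡ 0ℤ
δ-≢ = if-≟-≢

sum-*δ : ∀ {n} (x : Fin n → ℤ) i → sum (λ j → x j * δ i j) ≡ x i
sum-*δ x i = trans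
  (sum-single i λ j j≢i → trans (cong (x j *_) (δ-≢ (j≢i ∘ sym))) (ℤ.*-zeroʳ (x j)))
  (trans (cong (x i *_) (δ-refl i)) (ℤ.*-identityʳ (x i)))

∣tabulate∣ : ∀ {n} (p : Fin n → Bool) → + ∣ tabulate p ∣ ≡ sum (ι ∘ p)
∣tabulate∣ {zero}  p = refl
∣tabulate∣ {suc n} p with p zero
... | true  = cong (λ z → 1ℤ + z) (∣tabulate∣ (p ∘ suc))
... | false = trans (∣tabulate∣ (p ∘ suc)) (sym (ℤ.+-identityˡ _))

2∤1 : ¬ + 2 ∣ 1ℤ
2∤1 2∣1 = ℕ.≤⇒≯ (ℕ.∣⇒≤ (∣⇒∣ᵤ 2∣1)) ℕ.≤-refl

2∤-1 : ¬ + 2 ∣ -1ℤ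
2∤-1 2∣-1 = ℕ.≤⇒≯ (ℕ.∣⇒≤ (∣⇒∣ᵤ 2∣-1)) ℕ.≤-refl

-- Walks, paths and reachability

module _ {A : Set} {R : A → A → Set} (_≟ₐ_ : DecidableEquality A) where

  path-from : ∀ {u x v} ((w , _) : Path R x v) → u ∈ₗ visited w → Path R u v
  path-from (ε     , uniq)     (here refl) = ε , uniq
  path-from (r ◅ w , uniq)     (here refl) = r ◅ w , uniq
  path-from (r ◅ w , _ ∷ uniq) (there u∈w) = path-from (w , uniq) u∈w

  -- If the new first vertex already lies on the path built from the rest of the walk, the closed
  -- detour is dropped by passing to the suffix that starts there.
  star⇒path : ∀ {u v} → Star R u v → Path R u v
  star⇒path ε = ε , [] ∷ []
  star⇒path {u} (r ◅ w) with star⇒path w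
  ... | p@(w′ , uniq) with anyₗ? (u ≟ₐ_) (visited w′)
  ...   | yes u∈w′ = path-from p u∈w′
  ...   | no  u∉w′ = r ◅ w′ , ¬Any⇒All¬ _ u∉w′ ∷ uniq

crossing : ∀ {A : Set} {R : A → A → Set} (X : A → Bool) {u v} → Star R u v →
           X u ≡ true → X v ≡ false → ∃₂ λ x y → R x y × X x ≡ true × X y ≡ false
crossing X ε Xu Xv = contradiction (trans (sym Xu) Xv) λ ()
crossing X (_◅_ {u} {x} r w) Xu Xv with X x in eq
... | true  = crossing X w eq Xv
... | false = u , x , r , Xu , eq

module _ {n} {R : Fin n → Fin n → Set} (R? : ∀ x y → Dec (R x y)) (u : Fin n) where

  -- The walks bound `X` from above and closure bounds it from below, so `X` is exactly the set of
  -- vertices reachable from `u`.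
  ReachableSet : Set
  ReachableSet = Σ[ X ∈ Subset n ] (u ∈ X × (∀ {x} → x ∈ X → Star R u x) ×
                                    (∀ {x y} → x ∈ X → R x y → y ∈ X))

  -- `k` is fuel: it bounds the number of vertices outside `X`, and each round that does not stop
  -- adds a new vertex. With no fuel left, `X` contains every vertex.
  grow : ∀ k X → n ≤ k ℕ.+ ∣ X ∣ → u ∈ X → (∀ {x} → x ∈ X → Star R u x) → ReachableSet
  grow zero X n≤∣X∣ u∈X walk = X , u∈X , walk , λ {_} {y} _ _ →
    subst (y ∈_) (sym (∣p∣≡n⇒p≡⊤ (ℕ.≤-antisym (∣p∣≤n X) n≤∣X∣))) ∈⊤
  grow (suc k) X n≤k+∣X∣ u∈X walk
    with any? (λ x → any? λ y → (x ∈? X) ×-dec (¬? (y ∈? X) ×-dec R? x y))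
  ... | no none = X , u∈X , walk , λ {x} {y} x∈X r → closed x∈X r (y ∈? X)
    where
    closed : ∀ {x y} → x ∈ X → R x y → Dec (y ∈ X) → y ∈ X
    closed x∈X r (yes y∈X) = y∈X
    closed x∈X r (no  y∉X) = contradiction (_ , _ , x∈X , y∉X , r) none
  ... | yes (x , y , x∈X , y∉X , r) =
    grow k (X ∪ ⁅ y ⁆) n≤k+∣X∪y∣ (p⊆p∪q ⁅ y ⁆ u∈X) walk′
    where
    n≤k+∣X∪y∣ : n ≤ k ℕ.+ ∣ X ∪ ⁅ y ⁆ ∣
    n≤k+∣X∪y∣ = ℕ.≤-trans n≤k+∣X∣ (ℕ.≤-trans (ℕ.≤-reflexive (sym (ℕ.+-suc k ∣ X ∣)))
      (ℕ.+-monoʳ-≤ k (p⊂q⇒∣p∣<∣q∣ (p⊆p∪q ⁅ y ⁆ , y , q⊆p∪q X ⁅ y ⁆ (x∈⁅x⁆ y) , y∉X))))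
    walk′ : ∀ {z} → z ∈ X ∪ ⁅ y ⁆ → Star R u z
    walk′ z∈ with x∈p∪q⁻ X ⁅ y ⁆ z∈
    ... | inj₁ z∈X = walk z∈X
    ... | inj₂ z∈y with refl ← x∈⁅y⁆⇒x≡y y z∈y = walk x∈X ◅◅ (r ◅ ε)

  reachable-set : ReachableSet
  reachable-set = grow n ⁅ u ⁆ (ℕ.m≤m+n n _) (x∈⁅x⁆ u) λ {x} x∈u →
    subst (Star R u) (sym (x∈⁅y⁆⇒x≡y u x∈u)) ε

  star? : ∀ v → Dec (Star R u v)
  star? v with reachable-set
  ... | X , u∈X , walk , closed = map′ walk (stays u∈X) (v ∈? X)
    where
    stays : ∀ {x y} → x ∈ X → Star R x y → y ∈ X
    stays x∈X ε       = x∈X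
    stays x∈X (r ◅ w) = stays (closed x∈X r) w

  -- When `v` is unreachable, the reachable set is a cut that no arc leaves; this is the obstruction
  -- to deletability that counting will refute.
  star-or-closed : ∀ v → Star R u v ⊎
    ∃[ X ] (X u ≡ true × X v ≡ false × (∀ {x y} → X x ≡ true → R x y → X y ≡ true))
  star-or-closed v with reachable-set
  ... | X , u∈X , walk , closed with lookup X v in eq
  ...   | true  = inj₁ (walk (lookup⇒[]= v X eq))
  ...   | false = inj₂ (lookup X , []=⇒lookup u∈X , eq ,
                        λ {x} Xx r → []=⇒lookup (closed (lookup⇒[]= x X Xx) r))

-- Eulerian orientations

-- The signed incidence of an edge read from its first end to its second; a loop gives 0 everywhere.
-- Weighted by a flow and summed over the edges, it is outflow minus inflow at `v`.
bd : ∀ {n} → Fin n × Fin n → Fin n → ℤ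
bd (x , y) v = δ x v - δ y v

IsSign : ℤ → Set
IsSign z = z ≡ 1ℤ ⊎ z ≡ -1ℤ

module _ {n : ℕ} where

  -- Such an edge is a nonloop at `v`, so it can be listed with `v` first; `s` records whether this
  -- reverses it.
  bd-≢0⇒end : ∀ (e : Fin n × Fin n) v → bd e v ≢ 0ℤ →
              ∃₂ λ c s → IsSign s × (∀ w → bd e w ≡ s * bd (v , c) w)
  bd-≢0⇒end (x , y) v bd≢0 with x ≟ v | y ≟ v
  ... | yes refl | _        = y , 1ℤ , inj₁ refl , λ w → sym (ℤ.*-identityˡ _)
  ... | no _     | yes refl = x , -1ℤ , inj₂ refl , λ w → flipped (δ x w) (δ y w)
    where
    flipped : ∀ a b → a - b ≡ -1ℤ * (b - a)
    flipped = solve-∀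
  ... | no _     | no _     = contradiction refl bd≢0

  -- Two edges sharing a vertex b are merged into one edge that skips b; their
  -- signs are read off the sign of the merged edge.
  signs : ∀ {m} (end : Fin m → Fin n × Fin n) → (∀ v → + 2 ∣ sum (λ i → bd (end i) v)) →
          Σ[ s ∈ (Fin m → ℤ) ] ((∀ i → IsSign (s i)) × (∀ v → sum (λ i → s i * bd (end i) v) ≡ 0ℤ))
  signs {zero} end even = (λ ()) , (λ ()) , λ v → refl
  signs {suc m} end even with end zero
  ... | a , b with a ≟ b
  ...   | yes refl = s , s-sign , s-balanced
    where
    even′ : ∀ v → + 2 ∣ sum (λ i → bd (end (suc i)) v)
    even′ v = subst (+ 2 ∣_) (trans (cong (_+ _) (ℤ.+-inverseʳ (δ a v))) (ℤ.+-identityˡ _)) (even v)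
    rec = signs (end ∘ suc) even′
    s : Fin (suc m) → ℤ
    s zero    = 1ℤ
    s (suc i) = proj₁ rec i
    s-sign : ∀ i → IsSign (s i)
    s-sign zero    = inj₁ refl
    s-sign (suc i) = proj₁ (proj₂ rec) i
    s-balanced : ∀ v → 1ℤ * bd (a , a) v + sum (λ i → s (suc i) * bd (end (suc i)) v) ≡ 0ℤ
    s-balanced v = trans (cong (λ z → 1ℤ * bd (a , a) v + z) (proj₂ (proj₂ rec) v)) (loop (δ a v))
      where
      loop : ∀ p → 1ℤ * (p - p) + 0ℤ ≡ 0ℤ
      loop = solve-∀
  ...   | no a≢b with any? (λ i → ¬? (bd (end (suc i)) b ℤ.≟ 0ℤ))
  -- If no other edge had nonzero boundary at `b`, the boundary sum there would be the odd number
  -- -1.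
  ...     | no none = contradiction (subst (+ 2 ∣_) lonely (even b)) 2∤-1
    where
    vanishes : ∀ i → bd (end (suc i)) b ≡ 0ℤ
    vanishes i with bd (end (suc i)) b ℤ.≟ 0ℤ
    ... | yes eq = eq
    ... | no neq = contradiction (i , neq) none
    lonely : bd (a , b) b + sum (λ i → bd (end (suc i)) b) ≡ -1ℤ
    lonely = cong₂ _+_ (cong₂ _-_ (δ-≢ a≢b) (δ-refl b)) (sum-≡0 vanishes)
  ...     | yes (i , bd≢0) with bd-≢0⇒end (end (suc i)) b bd≢0
  ...       | c , t , t-sign , bd-i = s , s-sign , s-balanced
    where
    -- Edge `i`, which runs between `b` and `c`, is replaced by the merged edge from `a` to `c`.
    end′ : Fin m → Fin n × Fin n
    end′ j = if ⌊ j ≟ i ⌋ then (a , c) else end (suc j)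
    end′-i : end′ i ≡ (a , c)
    end′-i = if-≟-refl i
    end′-≢ : ∀ j → j ≢ i → end′ j ≡ end (suc j)
    end′-≢ j = if-≟-≢
    -- Merging keeps the total boundary if `t` is 1 and changes it by `2 (q - r)` if `t` is -1, so
    -- evenness survives.
    regroup : ∀ {t} → IsSign t → ∀ p q r S → + 2 ∣ (p - q) + S →
              + 2 ∣ S + ((p - r) - t * (q - r))
    regroup (inj₁ refl) p q r S = subst (+ 2 ∣_) (eq p q r S)
      where
      eq : ∀ p q r S → (p - q) + S ≡ S + ((p - r) - 1ℤ * (q - r))
      eq = solve-∀
    regroup (inj₂ refl) p q r S 2∣ =
      subst (+ 2 ∣_) (eq p q r S) (∣m∣n⇒∣m+n 2∣ (divides (q - r) refl))
      where
      eq : ∀ p q r S → ((p - q) + S) + (q - r) * + 2 ≡ S + ((p - r) - -1ℤ * (q - r))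
      eq = solve-∀
    even′ : ∀ v → + 2 ∣ sum (λ j → bd (end′ j) v)
    even′ v = subst (+ 2 ∣_)
      (sym (trans
        (sum-change (λ j → bd (end′ j) v) (λ j → bd (end (suc j)) v) i
          (λ j j≢i → cong (λ e → bd e v) (end′-≢ j j≢i)))
        (cong₂ (λ x y → sum (λ j → bd (end (suc j)) v) + (x - y))
          (cong (λ e → bd e v) end′-i) (bd-i v))))
      (regroup t-sign (δ a v) (δ b v) (δ c v) _ (even v))
    rec = signs end′ even′
    s′ = proj₁ rec
    -- Both original edges follow the merged edge along the route `a`, `b`, `c`; the factor `t`
    -- corrects for the listed direction of edge `i`.
    s : Fin (suc m) → ℤ
    s zero    = s′ i
    s (suc j) = if ⌊ j ≟ i ⌋ then t * s′ i else s′ j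
    s-i : s (suc i) ≡ t * s′ i
    s-i = if-≟-refl i
    s-≢ : ∀ j → j ≢ i → s (suc j) ≡ s′ j
    s-≢ j = if-≟-≢
    *-sign : ∀ {x y} → IsSign x → IsSign y → IsSign (x * y)
    *-sign (inj₁ refl) (inj₁ refl) = inj₁ refl
    *-sign (inj₁ refl) (inj₂ refl) = inj₂ refl
    *-sign (inj₂ refl) (inj₁ refl) = inj₂ refl
    *-sign (inj₂ refl) (inj₂ refl) = inj₁ refl
    s-sign : ∀ j → IsSign (s j)
    s-sign zero = proj₁ (proj₂ rec) i
    s-sign (suc j) = if-elim IsSign ⌊ j ≟ i ⌋ (*-sign t-sign (proj₁ (proj₂ rec) i)) (proj₁ (proj₂ rec) j)
    cancel : ∀ {t} → IsSign t → ∀ x p q r →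
             x * (p - q) + (0ℤ + ((t * x) * (t * (q - r)) - x * (p - r))) ≡ 0ℤ
    cancel (inj₁ refl) = eq
      where
      eq : ∀ x p q r → x * (p - q) + (0ℤ + ((1ℤ * x) * (1ℤ * (q - r)) - x * (p - r))) ≡ 0ℤ
      eq = solve-∀
    cancel (inj₂ refl) = eq
      where
      eq : ∀ x p q r → x * (p - q) + (0ℤ + ((-1ℤ * x) * (-1ℤ * (q - r)) - x * (p - r))) ≡ 0ℤ
      eq = solve-∀
    s-balanced : ∀ v → s′ i * bd (a , b) v + sum (λ j → s (suc j) * bd (end (suc j)) v) ≡ 0ℤ
    s-balanced v = begin
      s′ i * bd (a , b) v + sum x
        ≡⟨ cong (λ z → s′ i * bd (a , b) v + z) (sum-change x y i λ j j≢i →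
             cong₂ (λ z e → z * bd e v) (s-≢ j j≢i) (sym (end′-≢ j j≢i))) ⟩
      s′ i * bd (a , b) v + (sum y + (x i - y i))
        ≡⟨ cong (λ z → s′ i * bd (a , b) v + z) (cong₂ _+_ (proj₂ (proj₂ rec) v)
             (cong₂ _-_ (cong₂ _*_ s-i (bd-i v)) (cong (λ e → s′ i * bd e v) end′-i))) ⟩
      s′ i * bd (a , b) v + (0ℤ + ((t * s′ i) * (t * bd (b , c) v) - s′ i * bd (a , c) v))
        ≡⟨ cancel t-sign (s′ i) (δ a v) (δ b v) (δ c v) ⟩
      0ℤ ∎
      where
      open ≡-Reasoning
      x y : Fin m → ℤ
      x j = s (suc j) * bd (end (suc j)) v
      y j = s′ j * bd (end′ j) v

-- Flows with values 0 and ±1 in a prescribed parity class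

sum-∣ : ∀ {n d} {x : Fin n → ℤ} → (∀ i → d ∣ x i) → d ∣ sum x
sum-∣ {zero}  d∣x = divides 0ℤ refl
sum-∣ {suc n} d∣x = ∣m∣n⇒∣m+n (d∣x zero) (sum-∣ (d∣x ∘ suc))

residue : ∀ z → ∃[ b ] (+ 2 ∣ z - ι b)
residue z with z %ℕ 2 | n%ℕd<d z 2 | a≡a%ℕn+[a/ℕn]*n z 2
... | 0           | _            | eq = false , divides (z /ℕ 2) (trans (cong (_- 0ℤ) eq) (shift 0ℤ _))
  where
  shift : ∀ r q → (r + q) - r ≡ q
  shift = solve-∀
... | 1           | _            | eq = true , divides (z /ℕ 2) (trans (cong (_- 1ℤ) eq) (shift 1ℤ _))
  where
  shift : ∀ r q → (r + q) - r ≡ q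
  shift = solve-∀
... | suc (suc _) | s≤s (s≤s ()) | _

module _ {m n : ℕ} (end : Fin m → Fin n × Fin n) where

  Balanced : (Fin m → ℤ) → Set
  Balanced h = ∀ v → sum (λ e → h e * bd (end e) v) ≡ 0ℤ

  -- As the values are 0 and ±1, `parity` makes the support exactly the set of edges where `h` is
  -- odd. Since `h` enters only modulo 2, indicators of colour classes can serve as well as flows.
  record UnitFlow (h : Fin m → ℤ) : Set where
    field
      value    : Fin m → ℤ
      unit     : ∀ e → ℤ.∣ value e ∣ ≤ 1
      balanced : Balanced value
      parity   : ∀ e → + 2 ∣ h e - value e

  -- Edges of even value become loops, which do not affect the balance.
  unit-flow : ∀ h → (∀ v → + 2 ∣ sum (λ e → h e * bd (end e) v)) → UnitFlow h
  unit-flow h even = record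
    { value    = λ e → s e * ι (b e)
    ; unit     = λ e → small (b e) (proj₁ (proj₂ rec) e)
    ; balanced = λ v → trans
        (sum-cong-≗ λ e → trans (ℤ.*-assoc (s e) _ _) (cong (λ z → s e * z) (sym (bd-end′ e v))))
        (proj₂ (proj₂ rec) v)
    ; parity   = λ e → same-parity (h e) (b e) (proj₁ (proj₂ rec) e) (proj₂ (residue (h e)))
    }
    where
    b : Fin m → Bool
    b e = proj₁ (residue (h e))
    end′ : Fin m → Fin n × Fin n
    end′ e = if b e then end e else (proj₁ (end e) , proj₁ (end e))
    bd-end′ : ∀ e v → bd (end′ e) v ≡ ι (b e) * bd (end e) v
    bd-end′ e v with b e
    ... | true  = sym (ℤ.*-identityˡ _)
    ... | false = ℤ.+-inverseʳ (δ (proj₁ (end e)) v)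
    split : ∀ z r d → z * d ≡ (z - r) * d + r * d
    split = solve-∀
    even′ : ∀ v → + 2 ∣ sum (λ e → bd (end′ e) v)
    even′ v = subst (+ 2 ∣_) (sum-cong-≗ λ e → sym (bd-end′ e v))
      (∣m+n∣m⇒∣n
        (subst (+ 2 ∣_)
          (trans (sum-cong-≗ λ e → split (h e) (ι (b e)) (bd (end e) v))
                 (∑-distrib-+ (λ e → (h e - ι (b e)) * bd (end e) v) _))
          (even v))
        (sum-∣ λ e → ∣m⇒∣m*n (bd (end e) v) (proj₂ (residue (h e)))))
    rec = signs end′ even′
    s : Fin m → ℤ
    s = proj₁ rec
    small : ∀ {t} b → IsSign t → ℤ.∣ t * ι b ∣ ≤ 1
    small true  (inj₁ refl) = s≤s z≤n
    small true  (inj₂ refl) = s≤s z≤n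
    small false (inj₁ refl) = z≤n
    small false (inj₂ refl) = z≤n
    same-parity : ∀ {t} z b → IsSign t → + 2 ∣ z - ι b → + 2 ∣ z - t * ι b
    same-parity z true  (inj₁ refl) 2∣ = 2∣
    same-parity z true  (inj₂ refl) 2∣ =
      subst (+ 2 ∣_) (ℤ.+-assoc z -1ℤ (+ 2)) (∣m∣n⇒∣m+n 2∣ (divides 1ℤ refl))
    same-parity z false (inj₁ refl) 2∣ = 2∣
    same-parity z false (inj₂ refl) 2∣ = 2∣

positive : ℤ → Bool
positive (+ 0)       = false
positive (+ (suc _)) = true
positive -[1+ _ ]    = false

-- Cuts

private
  no-flow : ∀ z d → d ≡ d - z * 0ℤ
  no-flow = solve-∀

  entering⁺ : ∀ z d → d + z ≡ d - z * -1ℤ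
  entering⁺ = solve-∀

  entering⁻ : ∀ z d → d + - z ≡ d - z * 1ℤ
  entering⁻ = solve-∀

-- The contribution of one edge to the cut count. An edge entering `X` has `- z * (...)` at least 1;
-- an edge leaving it has value -1 there, which `d = 2` raises to 1; any other edge contributes `d`,
-- which is at least 0.
cut-edge-bound : ∀ {A : Set} (X : A → Bool) x y z {d} → 1 ≤ ℤ.∣ z ∣ → 0ℤ ℤ.≤ d →
  (X (if positive z then x else y) ≡ true → X (if positive z then y else x) ≡ false →
   ℤ.∣ z ∣ ≡ 1 × d ≡ + 2) →
  ι (X x xor X y) ℤ.≤ d - z * (ι (X x) - ι (X y))
cut-edge-bound X x y (+ 0) () _ _
cut-edge-bound X x y z@(+ (suc k)) {d} _ 0≤d leaving with X x | X y
... | true  | true  = subst (0ℤ ℤ.≤_) (no-flow z d) 0≤d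
... | false | false = subst (0ℤ ℤ.≤_) (no-flow z d) 0≤d
... | false | true  = subst (1ℤ ℤ.≤_) (entering⁺ z d) (ℤ.+-mono-≤ 0≤d (+≤+ (s≤s z≤n)))
... | true  | false with leaving refl refl
...   | refl , refl = +≤+ (s≤s z≤n)
cut-edge-bound X x y z@(-[1+ k ]) {d} _ 0≤d leaving with X x | X y
... | true  | true  = subst (0ℤ ℤ.≤_) (no-flow z d) 0≤d
... | false | false = subst (0ℤ ℤ.≤_) (no-flow z d) 0≤d
... | true  | false = subst (1ℤ ℤ.≤_) (entering⁻ z d) (ℤ.+-mono-≤ 0≤d (+≤+ (s≤s z≤n)))
... | false | true  with leaving refl refl
...   | refl , refl = +≤+ (s≤s z≤n)

-- Adds the conservation laws of all vertices with weights `ξ` and exchanges the sums. For the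
-- indicator of a vertex set, this says that the net flow across its cut is 0.
balanced-cut : ∀ {m n} (end : Fin m → Fin n × Fin n) g → Balanced end g → (ξ : Fin n → ℤ) →
               sum (λ e → g e * (ξ (proj₁ (end e)) - ξ (proj₂ (end e)))) ≡ 0ℤ
balanced-cut end g bal ξ = begin
  sum (λ e → g e * (ξ (proj₁ (end e)) - ξ (proj₂ (end e))))
    ≡⟨ sum-cong-≗ (λ e → cong (λ z → g e * z) (sym (sum-ξ e))) ⟩
  sum (λ e → g e * sum (λ v → ξ v * bd (end e) v))
    ≡⟨ sum-cong-≗ (λ e → *-distribˡ-sum (g e) (λ v → ξ v * bd (end e) v)) ⟩
  sum (λ e → sum (λ v → g e * (ξ v * bd (end e) v)))
    ≡⟨ ∑-comm (λ e v → g e * (ξ v * bd (end e) v)) ⟩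
  sum (λ v → sum (λ e → g e * (ξ v * bd (end e) v)))
    ≡⟨ sum-cong-≗ (λ v → trans (sum-cong-≗ λ e → swap (g e) (ξ v) (bd (end e) v))
                               (sym (*-distribˡ-sum (ξ v) (λ e → g e * bd (end e) v)))) ⟩
  sum (λ v → ξ v * sum (λ e → g e * bd (end e) v))
    ≡⟨ sum-≡0 (λ v → trans (cong (λ z → ξ v * z) (bal v)) (ℤ.*-zeroʳ (ξ v))) ⟩
  0ℤ ∎
  where
  open ≡-Reasoning
  swap : ∀ a b c → a * (b * c) ≡ b * (a * c)
  swap = solve-∀
  expand : ∀ a b c → a * (b - c) ≡ a * b - a * c
  expand = solve-∀
  sum-ξ : ∀ e → sum (λ v → ξ v * bd (end e) v) ≡ ξ (proj₁ (end e)) - ξ (proj₂ (end e))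
  sum-ξ e = trans (sum-cong-≗ λ v → expand (ξ v) (δ (proj₁ (end e)) v) (δ (proj₂ (end e)) v))
    (trans (sum-distrib-- (λ v → ξ v * δ (proj₁ (end e)) v) (λ v → ξ v * δ (proj₂ (end e)) v))
           (cong₂ _-_ (sum-*δ ξ (proj₁ (end e))) (sum-*δ ξ (proj₂ (end e)))))

module _ (G : Graph) where

  arc? : ∀ o F u v → Dec (Arc∖ G o F u v)
  arc? o F u v = any? λ e → ¬? (e ∈? F) ×-dec (tail G o e ≟ u) ×-dec (head G o e ≟ v)

  ∂ : (V G → Bool) → E G → Bool
  ∂ X e = X (proj₁ (ends G e)) xor X (proj₂ (ends G e))

  module _ (conn : EdgeConnected G 3) where

    -- Were the cut to have at most two edges, deleting them would leave a walk from `u` to `v`;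
    -- that walk leaves `X` along an edge outside the cut, which is absurd.
    cut-large : ∀ X {u v} → X u ≡ true → X v ≡ false → ¬ sum (ι ∘ ∂ X) ℤ.≤ + 2
    cut-large X {u} {v} Xu Xv small =
      impossible (crossing X (proj₁ (proj₂ conn F ∣F∣<3 u v)) Xu Xv)
      where
      F = tabulate (∂ X)
      ∣F∣<3 : ∣ F ∣ < 3
      ∣F∣<3 = s≤s (ℤ.drop‿+≤+ (subst (ℤ._≤ + 2) (sym (∣tabulate∣ (∂ X))) small))
      impossible : ¬ ∃₂ λ x y → Adjacent∖ G F x y × X x ≡ true × X y ≡ false
      impossible (x , y , (e , e∉F , joins) , Xx , Xy) = contra joins
        where
        not-cut : ∂ X e ≢ true
        not-cut ∂e = e∉F (lookup⇒[]= e F (trans (lookup∘tabulate (∂ X) e) ∂e))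
        ∂-ends : V G × V G → Bool
        ∂-ends (a , b) = X a xor X b
        contra : ¬ Joins G e x y
        contra (inj₁ eq) = not-cut (trans (cong ∂-ends eq) (cong₂ _xor_ Xx Xy))
        contra (inj₂ eq) = not-cut (trans (cong ∂-ends eq) (cong₂ _xor_ Xy Xx))

    -- If `v` is unreachable from `u` without `e₀`, only `e₀` can leave the set reachable from `u`.
    -- Summing `cut-edge-bound` and using that the net flow is 0 leaves a cut of at most two edges.
    unit-deletable : ∀ g → (∀ e → 1 ≤ ℤ.∣ g e ∣) → Balanced (ends G) g →
                     ∀ e₀ → ℤ.∣ g e₀ ∣ ≡ 1 → Deletable G (positive ∘ g) e₀
    unit-deletable g nz bal e₀ unit u v _ with star-or-closed (arc? o ⁅ e₀ ⁆) u v
      where o = positive ∘ g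
    ... | inj₁ w = star⇒path _≟_ w
    ... | inj₂ (X , Xu , Xv , closed) = contradiction small (cut-large X Xu Xv)
      where
      o = positive ∘ g
      d : E G → ℤ
      -- If `e₀` leaves `X` it contributes -1 where it must be counted as 1; the slack 2 makes up
      -- the difference and is the final bound.
      d e = + 2 * δ e₀ e
      0≤d : ∀ e → 0ℤ ℤ.≤ d e
      0≤d e with e₀ ≟ e
      ... | yes _ = +≤+ z≤n
      ... | no _  = +≤+ z≤n
      leaving : ∀ e → X (tail G o e) ≡ true → X (head G o e) ≡ false → ℤ.∣ g e ∣ ≡ 1 × d e ≡ + 2
      leaving e Xt Xh with e ≟ e₀
      ... | yes refl = unit , cong (λ z → + 2 * z) (δ-refl e)
      ... | no e≢e₀  = contradiction
        (trans (sym (closed Xt (e , (λ e∈ → e≢e₀ (x∈⁅y⁆⇒x≡y e₀ e∈)) , refl , refl))) Xh) λ ()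
      ξ = ι ∘ X
      h : E G → ℤ
      h e = g e * (ξ (proj₁ (ends G e)) - ξ (proj₂ (ends G e)))
      small : sum (ι ∘ ∂ X) ℤ.≤ + 2
      small = ℤ.≤-trans
        (sum-mono-≤ λ e → cut-edge-bound X _ _ (g e) (nz e) (0≤d e) (leaving e))
        (ℤ.≤-reflexive (trans (sum-distrib-- d h)
          (cong₂ _-_ (sum-*δ (λ _ → + 2) e₀) (balanced-cut (ends G) g bal ξ))))

-- Deletable covers from flows

module _ (G : Graph) where

  -- The unit coefficients are written out so that both cases are literal instances of
  -- `linear-balanced`.
  combination : Fin 2 → ℤ → ℤ → ℤ
  combination zero       x y = 1ℤ * x + + 2 * y
  combination (suc zero) x y = + 2 * x + -1ℤ * y

  CombinationUnits : ℤ → ℤ → Set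
  CombinationUnits x y =
    (∀ i → 1 ≤ ℤ.∣ combination i x y ∣) × ∃[ i ] ℤ.∣ combination i x y ∣ ≡ 1

  combination-units? : ∀ x y → Dec (CombinationUnits x y)
  combination-units? x y =
    all? (λ i → 1 ℕ.≤? ℤ.∣ combination i x y ∣) ×-dec any? (λ i → ℤ.∣ combination i x y ∣ ℕ.≟ 1)

  -- The first combination is ±1 when `y` is 0 or `- x`, the second when `x` is 0 or `y`. The eight
  -- remaining pairs are checked by evaluation.
  combination-units : ∀ x y → ℤ.∣ x ∣ ≤ 1 → ℤ.∣ y ∣ ≤ 1 → ¬ (x ≡ 0ℤ × y ≡ 0ℤ) → CombinationUnits x y
  combination-units (+ 0) (+ 0) _ _ nz = contradiction (refl , refl) nz
  combination-units (+ 0) (+ 1)       _ _ _ = from-yes (combination-units? (+ 0) (+ 1))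
  combination-units (+ 0) -[1+ 0 ]    _ _ _ = from-yes (combination-units? (+ 0) -[1+ 0 ])
  combination-units (+ 1) (+ 0)       _ _ _ = from-yes (combination-units? (+ 1) (+ 0))
  combination-units (+ 1) (+ 1)       _ _ _ = from-yes (combination-units? (+ 1) (+ 1))
  combination-units (+ 1) -[1+ 0 ]    _ _ _ = from-yes (combination-units? (+ 1) -[1+ 0 ])
  combination-units -[1+ 0 ] (+ 0)    _ _ _ = from-yes (combination-units? -[1+ 0 ] (+ 0))
  combination-units -[1+ 0 ] (+ 1)    _ _ _ = from-yes (combination-units? -[1+ 0 ] (+ 1))
  combination-units -[1+ 0 ] -[1+ 0 ] _ _ _ = from-yes (combination-units? -[1+ 0 ] -[1+ 0 ])
  combination-units (+ suc (suc _)) _ (s≤s ()) _ _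
  combination-units -[1+ suc _ ] _ (s≤s ()) _ _
  combination-units _ (+ suc (suc _)) _ (s≤s ()) _
  combination-units _ -[1+ suc _ ] _ (s≤s ()) _

  linear-balanced : ∀ x y → Balanced (ends G) x → Balanced (ends G) y →
                    ∀ a b → Balanced (ends G) (λ e → a * x e + b * y e)
  linear-balanced x y x-bal y-bal a b v = begin
    sum (λ e → (a * x e + b * y e) * B e)
      ≡⟨ sum-cong-≗ (λ e → expand a b (x e) (y e) (B e)) ⟩
    sum (λ e → a * (x e * B e) + b * (y e * B e))
      ≡⟨ ∑-distrib-+ (λ e → a * (x e * B e)) _ ⟩
    sum (λ e → a * (x e * B e)) + sum (λ e → b * (y e * B e))
      ≡⟨ cong₂ _+_ (*-distribˡ-sum a (λ e → x e * B e)) (*-distribˡ-sum b (λ e → y e * B e)) ⟨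
    a * sum (λ e → x e * B e) + b * sum (λ e → y e * B e)
      ≡⟨ cong₂ (λ p q → a * p + b * q) (x-bal v) (y-bal v) ⟩
    a * 0ℤ + b * 0ℤ
      ≡⟨ cong₂ _+_ (ℤ.*-zeroʳ a) (ℤ.*-zeroʳ b) ⟩
    0ℤ ∎
    where
    open ≡-Reasoning
    B : E G → ℤ
    B e = bd (ends G e) v
    expand : ∀ a b x y d → (a * x + b * y) * d ≡ a * (x * d) + b * (y * d)
    expand = solve-∀

  unit-flows⇒cover : EdgeConnected G 3 → ∀ {h k} (x : UnitFlow (ends G) h) (y : UnitFlow (ends G) k) →
    (∀ e → ¬ (UnitFlow.value x e ≡ 0ℤ × UnitFlow.value y e ≡ 0ℤ)) → DeletableCover G 2
  unit-flows⇒cover conn x y nz = (λ i → positive ∘ g i) , deletable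
    where
    module X = UnitFlow x
    module Y = UnitFlow y
    g : Fin 2 → E G → ℤ
    g i e = combination i (X.value e) (Y.value e)
    g-units : ∀ e → (∀ i → 1 ≤ ℤ.∣ g i e ∣) × ∃[ i ] ℤ.∣ g i e ∣ ≡ 1
    g-units e = combination-units _ _ (X.unit e) (Y.unit e) (nz e)
    g-balanced : ∀ i → Balanced (ends G) (g i)
    g-balanced zero       = linear-balanced X.value Y.value X.balanced Y.balanced 1ℤ (+ 2)
    g-balanced (suc zero) = linear-balanced X.value Y.value X.balanced Y.balanced (+ 2) -1ℤ
    deletable : ∀ e → ∃[ i ] Deletable G (positive ∘ g i) e
    deletable e with g-units e
    ... | _ , i , unit = i , unit-deletable G conn (g i) (λ e → proj₁ (g-units e) i) (g-balanced i) e unit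

  -- Splitting a nowhere-zero 4-flow into two unit flows

  module _ (fl : NowhereZeroFlow G 4) where
    open NowhereZeroFlow fl

    -- The flow rewritten relative to the listed order of the ends, so that it can be paired with
    -- `bd`.
    signed : E G → ℤ
    signed e = if orientation e then flow e else - flow e

    ∣signed∣ : ∀ e → ℤ.∣ signed e ∣ ≡ ℤ.∣ flow e ∣
    ∣signed∣ e with orientation e
    ... | true  = refl
    ... | false = ℤ.∣-i∣≡∣i∣ (flow e)

    signed-balanced : Balanced (ends G) signed
    signed-balanced v = begin
      sum (λ e → signed e * bd (ends G e) v)
        ≡⟨ sum-cong-≗ term ⟩
      sum (λ e → out e - inn e)
        ≡⟨ sum-distrib-- out inn ⟩
      outflow G orientation flow v - inflow G orientation flow v
        ≡⟨ ℤ.i≡j⇒i-j≡0 (sym (conserved v)) ⟩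
      0ℤ ∎
      where
      open ≡-Reasoning
      out inn : E G → ℤ
      out e = if ⌊ tail G orientation e ≟ v ⌋ then flow e else 0ℤ
      inn e = if ⌊ head G orientation e ≟ v ⌋ then flow e else 0ℤ
      forward : ∀ z p q → z * (p - q) ≡ z * p - z * q
      forward = solve-∀
      backward : ∀ z p q → (- z) * (p - q) ≡ z * q - z * p
      backward = solve-∀
      term : ∀ e → signed e * bd (ends G e) v ≡ out e - inn e
      term e with orientation e
      ... | true  = trans (forward (flow e) (δ (proj₁ (ends G e)) v) (δ (proj₂ (ends G e)) v))
        (sym (cong₂ _-_ (if-then-0 _ (flow e)) (if-then-0 _ (flow e))))
      ... | false = trans (backward (flow e) (δ (proj₁ (ends G e)) v) (δ (proj₂ (ends G e)) v))
        (sym (cong₂ _-_ (if-then-0 _ (flow e)) (if-then-0 _ (flow e))))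

    flow⇒cover : EdgeConnected G 3 → DeletableCover G 2
    flow⇒cover conn = unit-flows⇒cover conn x y not-both-zero
      where
      balanced⇒even : ∀ h → Balanced (ends G) h → ∀ v → + 2 ∣ sum (λ e → h e * bd (ends G e) v)
      balanced⇒even h bal v = divides 0ℤ (bal v)
      x = unit-flow (ends G) signed (balanced⇒even signed signed-balanced)
      module X = UnitFlow x
      half : E G → ℤ
      half e = _∣_.quotient (X.parity e)
      half-eq : ∀ e → signed e - X.value e ≡ half e * + 2
      half-eq e = _∣_.equality (X.parity e)
      halve : ∀ {z} → + 2 * z ≡ 0ℤ → z ≡ 0ℤ
      halve {z} 2z≡0 with ℤ.i*j≡0⇒i≡0∨j≡0 (+ 2) {z} 2z≡0
      ... | inj₂ z≡0 = z≡0
      -- Twice `half` is the difference of two balanced functions, and the integers have no zero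
      -- divisors.
      half-balanced : Balanced (ends G) half
      half-balanced v = halve (begin
        + 2 * sum (λ e → half e * B e)
          ≡⟨ *-distribˡ-sum (+ 2) (λ e → half e * B e) ⟩
        sum (λ e → + 2 * (half e * B e))
          ≡⟨ sum-cong-≗ (λ e → trans (reassoc (half e) (B e)) (cong (_* B e) (sym (half-eq e)))) ⟩
        sum (λ e → (signed e - X.value e) * B e)
          ≡⟨ sum-cong-≗ (λ e → as-linear (signed e) (X.value e) (B e)) ⟩
        sum (λ e → (1ℤ * signed e + -1ℤ * X.value e) * B e)
          ≡⟨ linear-balanced signed X.value signed-balanced X.balanced 1ℤ -1ℤ v ⟩
        0ℤ ∎)
        where
        open ≡-Reasoning
        B : E G → ℤ
        B e = bd (ends G e) v
        reassoc : ∀ q d → + 2 * (q * d) ≡ (q * + 2) * d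
        reassoc = solve-∀
        as-linear : ∀ p q d → (p - q) * d ≡ (1ℤ * p + -1ℤ * q) * d
        as-linear = solve-∀
      y = unit-flow (ends G) half (balanced⇒even half half-balanced)
      module Y = UnitFlow y
      not-both-zero : ∀ e → ¬ (X.value e ≡ 0ℤ × Y.value e ≡ 0ℤ)
      -- If both vanish, `signed e` is twice `half e` and `half e` is even, so 4 divides a nonzero
      -- value of size less than 4.
      not-both-zero e (x≡0 , y≡0) = ℕ.≤⇒≯ 4≤ (bounded e)
        where
        drop-0 : ∀ p q {r} → r ≡ 0ℤ → p - r ≡ q → p ≡ q
        drop-0 p q refl eq = trans (sym (ℤ.+-identityʳ p)) eq
        4∣signed : + 4 ∣ signed e
        4∣signed = divides (_∣_.quotient (Y.parity e))
          (trans (drop-0 _ (half e * + 2) x≡0 (half-eq e))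
            (trans (cong (_* + 2) {x = half e} (drop-0 (half e) _ y≡0 (_∣_.equality (Y.parity e))))
              (ℤ.*-assoc (_∣_.quotient (Y.parity e)) (+ 2) (+ 2))))
        4≤ : 4 ≤ ℤ.∣ flow e ∣
        4≤ = ℕ.∣⇒≤ {{ℕ.>-nonZero (nonzero e)}} (subst (4 ℕ.∣_) (∣signed∣ e) (∣⇒∣ᵤ 4∣signed))

  -- Deciding covers by one orientation, and exact Frank numbers

  deletable? : ∀ o e → Dec (Deletable G o e)
  deletable? o e = all? λ u → all? λ v →
    ¬? (u ≟ v) →-dec map′ (star⇒path _≟_) proj₁ (star? (arc? G o ⁅ e ⁆) u v)

  -- Encoding an orientation as a bit vector and decoding it returns the orientation only up to
  -- pointwise equality.
  deletable-resp-≗ : ∀ {o o′} → o ≗ o′ → ∀ {e} → Deletable G o e → Deletable G o′ e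
  deletable-resp-≗ o≗o′ del u v u≢v = star⇒path _≟_ (gmap (λ x → x)
    (λ { (e , e∉ , t , h) → e , e∉
       , trans (cong (λ b → if b then proj₁ (ends G e) else proj₂ (ends G e)) (sym (o≗o′ e))) t
       , trans (cong (λ b → if b then proj₂ (ends G e) else proj₁ (ends G e)) (sym (o≗o′ e))) h })
    (proj₁ (del u v u≢v)))

  cover₁⇒ : DeletableCover G 1 → ∃[ o ] (∀ e → Deletable G o e)
  cover₁⇒ (o , cov) = o zero , λ e → at (cov e)
    where
    at : ∀ {e} → ∃[ i ] Deletable G (o i) e → Deletable G (o zero) e
    at (zero , del) = del

  -- Orientations are encoded as subsets of the edge set, which makes the search finite.
  cover₁? : Dec (DeletableCover G 1)
  cover₁? = map′
    (λ (S , del) → (λ _ → lookup S) , λ e → zero , del e)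
    (λ cov → tabulate (proj₁ (cover₁⇒ cov)) ,
       λ e → deletable-resp-≗ (sym ∘ lookup∘tabulate _) (proj₂ (cover₁⇒ cov) e))
    (anySubset? λ S → all? (deletable? (lookup S)))

  module _ (conn : EdgeConnected G 3) where

    other-vertex : ∀ v → ∃[ w ] v ≢ w
    other-vertex v = other (proj₁ conn) v
      where
      other : ∀ {n} → 2 ≤ n → (v : Fin n) → ∃[ w ] v ≢ w
      other (s≤s (s≤s _)) zero    = suc zero , λ ()
      other (s≤s (s≤s _)) (suc v) = zero , λ ()

    some-vertex : V G
    some-vertex = vertex (proj₁ conn)
      where
      vertex : ∀ {n} → 2 ≤ n → Fin n
      vertex (s≤s _) = zero

    some-edge : E G
    some-edge with other-vertex some-vertex
    ... | w , v≢w with proj₁ (proj₂ conn ∅ (subst (_< 3) (sym (∣⊥∣≡0 (size G))) (s≤s z≤n)) some-vertex w)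
    ...   | ε           = contradiction refl v≢w
    ...   | (e , _) ◅ _ = e

    ¬cover₀ : ¬ DeletableCover G 0
    ¬cover₀ (_ , cov) with cov some-edge
    ... | () , _

    frank-2 : DeletableCover G 2 → ¬ DeletableCover G 1 → IsFrankNumber G 2
    frank-2 cov ¬cov₁ = cov , minimal
      where
      minimal : ∀ j → DeletableCover G j → 2 ≤ j
      minimal 0             cov₀ = contradiction cov₀ ¬cover₀
      minimal 1             cov₁ = contradiction cov₁ ¬cov₁
      minimal (suc (suc j)) _    = s≤s (s≤s z≤n)

    -- The minimum itself must be exhibited, so it has to be decided whether one orientation already
    -- suffices.
    frank-≤2 : DeletableCover G 2 → ∃[ k ] (IsFrankNumber G k × k ≤ 2)
    frank-≤2 cov with cover₁?
    ... | no ¬cov₁ = 2 , frank-2 cov ¬cov₁ , ℕ.≤-refl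
    ... | yes cov₁ = 1 , (cov₁ , minimal) , s≤s z≤n
      where
      minimal : ∀ j → DeletableCover G j → 1 ≤ j
      minimal 0       cov₀ = contradiction cov₀ ¬cover₀
      minimal (suc j) _    = s≤s z≤n

-- Three-edge-colourings

module _ (G : Graph) (conn : EdgeConnected G 3) (colour : E G → Fin 3)
  (proper : ∀ e e′ v → e ≢ e′ → Incident G e v → Incident G e′ v → colour e ≢ colour e′) where

  single : V G → V G → Bool
  single v x = ⌊ x ≟ v ⌋

  single-refl : ∀ v → single v v ≡ true
  single-refl v with v ≟ v
  ... | yes _  = refl
  ... | no v≢v = contradiction refl v≢v

  single-true : ∀ {v x} → single v x ≡ true → x ≡ v
  single-true {v} {x} eq with x ≟ v
  ... | yes x≡v = x≡v

  single-false : ∀ {v x} → x ≢ v → single v x ≡ false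
  single-false {v} {x} x≢v with x ≟ v
  ... | yes x≡v = contradiction x≡v x≢v
  ... | no _    = refl

  tail-incident : ∀ o {e v} → tail G o e ≡ v → Incident G e v
  tail-incident o {e} eq with o e
  ... | true  = inj₁ eq
  ... | false = inj₂ eq

  head-incident : ∀ o {e v} → head G o e ≡ v → Incident G e v
  head-incident o {e} eq with o e
  ... | true  = inj₂ eq
  ... | false = inj₁ eq

  -- Deleting an arc out of v must leave another arc out of v, and likewise for
  -- the arcs into v: then v has four edges, too many for three colours.
  ¬cover₁ : ¬ DeletableCover G 1
  ¬cover₁ cov with cover₁⇒ G cov | other-vertex G conn (some-vertex G conn)
  ... | o , del | w , v≢w = too-many (pigeonhole ℕ.≤-refl (λ i → colour (Vec.lookup es i)))
    where
    v = some-vertex G conn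
    out-arc : ∀ e → ∃[ e′ ] (e ≢ e′ × tail G o e′ ≡ v × head G o e′ ≢ v)
    out-arc e with crossing (single v) (proj₁ (del e v w v≢w)) (single-refl v) (single-false (v≢w ∘ sym))
    ... | _ , _ , (e′ , e′∉ , refl , refl) , t , h =
      e′ , (λ { refl → e′∉ (x∈⁅x⁆ e) }) , single-true t ,
      λ h≡v → contradiction (trans (sym h) (trans (cong (single v) h≡v) (single-refl v))) λ ()
    in-arc : ∀ e → ∃[ e′ ] (e ≢ e′ × head G o e′ ≡ v × tail G o e′ ≢ v)
    -- Leaving the complement of `v` means entering `v`.
    in-arc e with crossing (not ∘ single v) (proj₁ (del e w v (v≢w ∘ sym)))
                    (cong not (single-false (v≢w ∘ sym))) (cong not (single-refl v))
    ... | _ , _ , (e′ , e′∉ , refl , refl) , t , h =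
      e′ , (λ { refl → e′∉ (x∈⁅x⁆ e) }) , single-true (not-injective h) ,
      λ t≡v → contradiction (trans (sym t) (cong not (trans (cong (single v) t≡v) (single-refl v)))) λ ()
    -- Deleting an arbitrary edge yields a first arc; deleting that arc yields a second, distinct
    -- one.
    out₁ = out-arc (some-edge G conn)
    out₂ = out-arc (proj₁ out₁)
    in₁  = in-arc (some-edge G conn)
    in₂  = in-arc (proj₁ in₁)
    es : Vec (E G) 4
    es = proj₁ out₁ ∷ proj₁ out₂ ∷ proj₁ in₁ ∷ proj₁ in₂ ∷ []
    -- The arcs chosen out of `v` are not loops, so their heads tell them apart from the arcs into
    -- `v`.
    out≢in : ∀ {e e′} → head G o e ≢ v → head G o e′ ≡ v → e ≢ e′
    out≢in h≢v h≡v refl = h≢v h≡v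
    out₁-head = proj₂ (proj₂ (proj₂ out₁))
    out₂-head = proj₂ (proj₂ (proj₂ out₂))
    in₁-head = proj₁ (proj₂ (proj₂ in₁))
    in₂-head = proj₁ (proj₂ (proj₂ in₂))
    es-unique : UniqueV.Unique es
    es-unique =
      (proj₁ (proj₂ out₂) ∷ out≢in out₁-head in₁-head ∷ out≢in out₁-head in₂-head ∷ []) ∷
      (out≢in out₂-head in₁-head ∷ out≢in out₂-head in₂-head ∷ []) ∷
      (proj₁ (proj₂ in₂) ∷ []) ∷ [] ∷ []
    es-incident : ∀ i → Incident G (Vec.lookup es i) v
    es-incident = lookup⁺ {P = λ e → Incident G e v}
      (tail-incident o (proj₁ (proj₂ (proj₂ out₁))) ∷ tail-incident o (proj₁ (proj₂ (proj₂ out₂))) ∷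
       head-incident o in₁-head ∷ head-incident o in₂-head ∷ [])
    too-many : ¬ ∃₂ λ i j → i Fin.< j × colour (Vec.lookup es i) ≡ colour (Vec.lookup es j)
    too-many (i , j , i<j , same) =
      proper _ _ v (λ eq → Fin.<⇒≢ i<j (lookup-injective es-unique i j eq))
        (es-incident i) (es-incident j) same

  -- Colour classes at a vertex and the flows they carry

  at : V G → E G → Bool
  at v = ∂ G (single v)

  at-incident : ∀ {v} e → at v e ≡ true → Incident G e v
  at-incident {v} e eq with proj₁ (ends G e) ≟ v
  ... | yes a≡v = inj₁ a≡v
  ... | no _    = inj₂ (single-true eq)

  -- The exclusive or in `at` rules out loops, whose boundary would cancel.
  at-true : ∀ {v} e → at v e ≡ true → IsSign (bd (ends G e) v)
  at-true {v} e eq with proj₁ (ends G e) ≟ v | proj₂ (ends G e) ≟ v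
  ... | yes _ | no _  = inj₁ refl
  ... | no _  | yes _ = inj₂ refl

  at-false : ∀ {v} e → at v e ≡ false → bd (ends G e) v ≡ 0ℤ
  at-false {v} e eq with proj₁ (ends G e) ≟ v | proj₂ (ends G e) ≟ v
  ... | yes _ | yes _ = refl
  ... | no _  | no _  = refl

  class : Fin 3 → E G → ℤ
  class k e = δ (colour e) k

  class-count : Fin 3 → V G → ℤ
  class-count k v = sum (λ e → class k e * ι (at v e))

  class-net : Fin 3 → V G → ℤ
  class-net k v = sum (λ e → class k e * bd (ends G e) v)

  class-vanishes : ∀ {k v e} y → ¬ (colour e ≡ k × at v e ≡ true) →
                   (at v e ≡ false → y ≡ 0ℤ) → class k e * y ≡ 0ℤ
  class-vanishes {k} {v} {e} y other y≡0 with colour e ≟ k | at v e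
  ... | no _  | _     = refl
  ... | yes _ | false = cong (λ z → 1ℤ * z) (y≡0 refl)
  ... | yes c | true  = contradiction (c , refl) other

  -- Properness allows at most one edge of each colour at `v`, so each sum has at most one nonzero
  -- term.
  one-or-none : ∀ k v → (class-count k v ≡ 1ℤ × IsSign (class-net k v)) ⊎ class-count k v ≡ 0ℤ
  one-or-none k v with any? (λ e → (colour e ≟ k) ×-dec (at v e Bool.≟ true))
  ... | no none = inj₂ (sum-≡0 λ e → class-vanishes {k} {v} {e} _ (λ c → none (e , c)) (cong ι))
  ... | yes (e , refl , e-at) = inj₁
    ( trans (sum-single e λ j j≢e → class-vanishes {k} {v} {j} _ (unique j≢e) (cong ι))
            (cong₂ _*_ (δ-refl (colour e)) (cong ι e-at))
    , subst IsSign
        (sym (trans (sum-single e λ j j≢e → class-vanishes {k} {v} {j} _ (unique j≢e) (at-false j))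
                    (trans (cong (_* bd (ends G e) v) (δ-refl (colour e))) (ℤ.*-identityˡ _))))
        (at-true e e-at))
    where
    unique : ∀ {j} → j ≢ e → ¬ (colour j ≡ colour e × at v j ≡ true)
    unique {j} j≢e (same , j-at) = proper j e v j≢e (at-incident j j-at) (at-incident e e-at) same

  -- Every edge has exactly one colour, so the colour counts add up to the size of the cut around
  -- `v`.
  sum-class : ∀ v → sum (λ k → class-count k v) ≡ sum (ι ∘ at v)
  sum-class v = trans (∑-comm (λ k e → class k e * ι (at v e)))
    (sum-cong-≗ λ e → trans (sum-cong-≗ λ k → ℤ.*-comm (class k e) (ι (at v e)))
                            (sum-*δ (λ _ → ι (at v e)) (colour e)))

  -- A colour missing at `v` would leave at most two edges in the cut around `v`; hence every colour
  -- occurs there exactly once.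
  class-net-sign : ∀ k v → IsSign (class-net k v)
  class-net-sign k v with one-or-none k v
  ... | inj₁ (_ , sign) = sign
  ... | inj₂ none with other-vertex G conn v
  ...   | w , v≢w = contradiction small (cut-large G conn (single v) (single-refl v) (single-false (v≢w ∘ sym)))
    where
    -- Upper bounds on the colour counts: 0 for the missing colour `k` and 1 for the other two.
    others : Fin 3 → ℤ
    others j = if ⌊ j ≟ k ⌋ then 0ℤ else 1ℤ
    count≤ : ∀ j → class-count j v ℤ.≤ others j
    count≤ j with j ≟ k
    ... | yes refl = ℤ.≤-reflexive none
    ... | no _ with one-or-none j v
    ...   | inj₁ (one , _) = ℤ.≤-reflexive one
    ...   | inj₂ nought    = subst (ℤ._≤ 1ℤ) (sym nought) (+≤+ z≤n)
    two : ∀ k → sum (λ j → if ⌊ j ≟ k ⌋ then 0ℤ else 1ℤ) ≡ + 2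
    two zero             = refl
    two (suc zero)       = refl
    two (suc (suc zero)) = refl
    small : sum (ι ∘ at v) ℤ.≤ + 2
    small = subst₂ ℤ._≤_ (sum-class v) (two k) (sum-mono-≤ count≤)

  sign+sign-even : ∀ {p q} → IsSign p → IsSign q → + 2 ∣ p + q
  sign+sign-even (inj₁ refl) (inj₁ refl) = divides 1ℤ refl
  sign+sign-even (inj₁ refl) (inj₂ refl) = divides 0ℤ refl
  sign+sign-even (inj₂ refl) (inj₁ refl) = divides 0ℤ refl
  sign+sign-even (inj₂ refl) (inj₂ refl) = divides -1ℤ refl

  two-classes : Fin 3 → Fin 3 → E G → ℤ
  two-classes j k e = class j e + class k e

  -- At every vertex each of the two classes has net boundary ±1, so together they have an even one.
  two-classes-flow : ∀ j k → UnitFlow (ends G) (two-classes j k)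
  two-classes-flow j k = unit-flow (ends G) (two-classes j k) λ v →
    subst (+ 2 ∣_)
      (sym (trans (sum-cong-≗ λ e → ℤ.*-distribʳ-+ (bd (ends G e) v) (class j e) (class k e))
                  (∑-distrib-+ (λ e → class j e * bd (ends G e) v) _)))
      (sign+sign-even (class-net-sign j v) (class-net-sign k v))

  -- Every colour lies in one of the two chosen pairs; there the prescribed value is 1, and an odd
  -- value cannot vanish.
  colouring⇒cover : DeletableCover G 2
  colouring⇒cover = unit-flows⇒cover G conn x y not-both-zero
    where
    x = two-classes-flow zero (suc zero)
    y = two-classes-flow zero (suc (suc zero))
    odd-value : ∀ {j k} (z : UnitFlow (ends G) (two-classes j k)) e →
                two-classes j k e ≡ 1ℤ → UnitFlow.value z e ≢ 0ℤ
    odd-value z e one z≡0 = 2∤1 (subst (+ 2 ∣_) (cong₂ _-_ one z≡0) (UnitFlow.parity z e))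
    not-both-zero : ∀ e → ¬ (UnitFlow.value x e ≡ 0ℤ × UnitFlow.value y e ≡ 0ℤ)
    not-both-zero e (x≡0 , y≡0) = by-colour (colour e) refl
      where
      by-colour : ∀ k → colour e ≢ k
      by-colour zero             eq = odd-value x e (cong (λ c → δ c zero + δ c (suc zero)) eq) x≡0
      by-colour (suc zero)       eq = odd-value x e (cong (λ c → δ c zero + δ c (suc zero)) eq) x≡0
      by-colour (suc (suc zero)) eq = odd-value y e (cong (λ c → δ c zero + δ c (suc (suc zero))) eq) y≡0

theorem2 : ((G : Graph) → EdgeConnected G 3 → NowhereZeroFlow G 4 → ∃[ k ] (IsFrankNumber G k × k ≤ 2))
    × ((G : Graph) → EdgeConnected G 3 → EdgeColourable G 3 → IsFrankNumber G 2)
theorem2 =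
  (λ G conn fl → frank-≤2 G conn (flow⇒cover G fl conn)) ,
  (λ G conn (colour , proper) →
    frank-2 G conn (colouring⇒cover G conn colour proper) (¬cover₁ G conn colour proper))
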